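{- For every constant $C$ there exist an integer $k\geq 1$ and a finite simple graph with minimum degree at least $k+C\sqrt{k}$ that has no $(k+1)$-edge-connected subgraph.
   Context: A graph $H$ is $(k+1)$-edge-connected if it has at least two vertices and for every partition of $V(H)$ into two nonempty sets, at least $k+1$ edges join the two sets. -}

module Defs where

open import Data.Nat using (ℕ; zero; suc; _+_; _*_; _∸_; _^_; _≤_)
open import Data.Bool using (Bool; true; false; _∧_; not; if_then_else_)
open import Data.Fin using (Fin)
open import Data.List using (List; map; allFin)
open import Data.Nat.ListAction using (sum)
open import Data.Product using (Σ; ∃; ∃-syntax; _×_; _,_)
open import Relation.Binary.PropositionalEquality using (_≡_; _≢_)

record Graph : Set where
  field
    n      : ℕ
    adj    : Fin n → Fin n → Bool
    adj-sym : ∀ u v → adj u v ≡ adj v u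
    adj-irr : ∀ v → adj v v ≡ false
open Graph public

count : ∀ {m} → (Fin m → Bool) → ℕ
count {m} f = sum (map (λ i → if f i then 1 else 0) (allFin m))

degree : (G : Graph) → Fin (n G) → ℕ
degree G v = count (adj G v)

record Subgraph (G : Graph) : Set where
  field
    inV    : Fin (n G) → Bool
    inE    : Fin (n G) → Fin (n G) → Bool
    inE-sym : ∀ u v → inE u v ≡ inE v u
    inE-adj : ∀ u v → inE u v ≡ true → adj G u v ≡ true
    inE-inV : ∀ u v → inE u v ≡ true → inV u ≡ true
open Subgraph public

crossing : {G : Graph} → Subgraph G → (Fin (n G) → Bool) → ℕ
crossing {G} H A =
  sum (map (λ u → count (λ v → A u ∧ inV H u ∧ not (A v) ∧ inV H v ∧ inE H u v))
           (allFin (n G)))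

EdgeConnected : {G : Graph} → ℕ → Subgraph G → Set
EdgeConnected {G} m H =
  (∃[ u ] ∃[ v ] (u ≢ v × inV H u ≡ true × inV H v ≡ true)) ×
  ((A : Fin (n G) → Bool) →
     (∀ u → A u ≡ true → inV H u ≡ true) →
     (∃[ u ] A u ≡ true) →
     (∃[ v ] (inV H v ≡ true × A v ≡ false)) →
     m ≤ crossing H A)

-- every vertex of G has degree ≥ k + C√k, encoded for C, k ∈ ℕ as
-- deg ≥ k and (deg − k)² ≥ C²·k.
MinDegreeAtLeast : Graph → (k C : ℕ) → Set
MinDegreeAtLeast G k C =
  ∀ v → (k ≤ degree G v) × (C * C * k ≤ (degree G v ∸ k) ^ 2)

{-# OPTIONS --safe #-}
module Submission where

-- The vertices sit in a binary tree of depth d, and a highly connected subgraph is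
-- chased from the root down to a leaf.  The two halves below a node are joined by only
-- k edges, namely t from each of the a hub vertices (A) of either half, where
-- k = 2at, so the subgraph lies in one half.  In that half the hubs have lost their t
-- cross edges; their degree has dropped from k + t to k, so they are not in the
-- subgraph.  A leaf vertex of type B is adjacent to the hubs on all d levels above it, so
-- it has degree k + da but only k neighbours inside its leaf; once the B's are gone, the
-- remaining vertices (F) have degree k as well, and nothing is left.  With d > 2C²,
-- a = 2^d and t = da one has t² = da·t ≥ C²·2at = C²k.

open import Defs
open import Data.Bool using (Bool; true; false; _∧_; _xor_; not; if_then_else_)
import Data.Bool.Properties as Bool
open import Data.Empty using (⊥)
open import Data.Fin using (Fin; zero; suc)
import Data.Fin as Fin
import Data.Fin.Properties as Fin
open import Data.List using (List; []; _∷_; _++_; map; length; replicate; upTo; applyUpTo; allFin; lookup; tabulate)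
open import Data.List.Properties using (map-++; map-∘; map-cong; map-tabulate; tabulate-lookup; map-upTo)
open import Data.Maybe using (Maybe; just; nothing; maybe′; _>>=_)
open import Data.Nat using (ℕ; zero; suc; _+_; _*_; _∸_; _^_; _≤_; _<ᵇ_; z≤n; s≤s)
open import Data.Nat.ListAction using (sum)
open import Data.Nat.ListAction.Properties using (sum-++)
open import Data.Nat.Properties
open import Data.Nat.Tactic.RingSolver using (solve-∀)
open import Data.Product using (∃-syntax; _×_; _,_; proj₁; proj₂)
open import Function using (_∘_; const)
open import Relation.Binary.PropositionalEquality using (_≡_; refl; sym; trans; cong; cong₂; subst; module ≡-Reasoning)
open import Relation.Nullary using (¬_; yes; no; does; contradiction)
open import Relation.Nullary.Decidable using (dec-true)

-- Finite sums over lists.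

⟦_⟧ : Bool → ℕ
⟦ b ⟧ = if b then 1 else 0

∑ : ∀ {A : Set} → (A → ℕ) → List A → ℕ
∑ f xs = sum (map f xs)

∑-cong : ∀ {A : Set} {f g : A → ℕ} → (∀ x → f x ≡ g x) → ∀ xs → ∑ f xs ≡ ∑ g xs
∑-cong f≗g xs = cong sum (map-cong f≗g xs)

∑-mono : ∀ {A : Set} {f g : A → ℕ} → (∀ x → f x ≤ g x) → ∀ xs → ∑ f xs ≤ ∑ g xs
∑-mono f≤g []       = z≤n
∑-mono f≤g (x ∷ xs) = +-mono-≤ (f≤g x) (∑-mono f≤g xs)

∑-++ : ∀ {A : Set} (f : A → ℕ) xs ys → ∑ f (xs ++ ys) ≡ ∑ f xs + ∑ f ys
∑-++ f xs ys = trans (cong sum (map-++ f xs ys)) (sum-++ (map f xs) (map f ys))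

∑-map : ∀ {A B : Set} (f : B → ℕ) (g : A → B) xs → ∑ f (map g xs) ≡ ∑ (f ∘ g) xs
∑-map f g xs = cong sum (sym (map-∘ xs))

∑-replicate : ∀ {A : Set} (f : A → ℕ) m x → ∑ f (replicate m x) ≡ m * f x
∑-replicate f zero    x = refl
∑-replicate f (suc m) x = cong (f x +_) (∑-replicate f m x)

∑-const : ∀ {A : Set} c (xs : List A) → ∑ (const c) xs ≡ length xs * c
∑-const c []       = refl
∑-const c (x ∷ xs) = cong (c +_) (∑-const c xs)

∑-zero : ∀ {A : Set} (xs : List A) → ∑ (const 0) xs ≡ 0
∑-zero xs = trans (∑-const 0 xs) (*-zeroʳ (length xs))

∑-* : ∀ {A : Set} c (f : A → ℕ) xs → ∑ (λ x → c * f x) xs ≡ c * ∑ f xs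
∑-* c f []       = sym (*-zeroʳ c)
∑-* c f (x ∷ xs) = trans (cong (c * f x +_) (∑-* c f xs)) (sym (*-distribˡ-+ c (f x) _))

∑-lookup : ∀ {A : Set} (f : A → ℕ) xs → ∑ (f ∘ lookup xs) (allFin (length xs)) ≡ ∑ f xs
∑-lookup f xs = cong sum (begin
  map (f ∘ lookup xs) (allFin (length xs))         ≡⟨ map-∘ (allFin (length xs)) ⟩
  map f (map (lookup xs) (allFin (length xs)))     ≡⟨ cong (map f) (map-tabulate (λ i → i) (lookup xs)) ⟩
  map f (tabulate (lookup xs))           ≡⟨ cong (map f) (tabulate-lookup xs) ⟩
  map f xs                                         ∎)
  where open ≡-Reasoning

∑-one : ∀ m → ∑ (const 1) (upTo m) ≡ m
∑-one m = trans (cong sum (map-upTo (const 1) m)) (go m)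
  where
  go : ∀ m → sum (applyUpTo (const 1) m) ≡ m
  go zero    = refl
  go (suc m) = cong suc (go m)

∑-<ᵇ : ∀ {m n} → m ≤ n → ∑ (λ i → ⟦ i <ᵇ m ⟧) (upTo n) ≡ m
∑-<ᵇ {m} {n} m≤n = trans (cong sum (map-upTo _ n)) (go m≤n)
  where
  go : ∀ {m n} → m ≤ n → sum (applyUpTo (λ i → ⟦ i <ᵇ m ⟧) n) ≡ m
  go {n = zero}  z≤n       = refl
  go {n = suc n} z≤n       = go {n = n} z≤n
  go             (s≤s m≤n) = cong suc (go m≤n)

∑-allFin-suc : ∀ {m} (f : Fin (suc m) → ℕ) → ∑ f (allFin (suc m)) ≡ f zero + ∑ (f ∘ suc) (allFin m)
∑-allFin-suc {m} f = cong (λ xs → f zero + sum xs)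
  (trans (map-tabulate suc f) (sym (map-tabulate (λ i → i) (f ∘ suc))))

∑-δ : ∀ {m} (v : Fin m) c → ∑ (λ u → if does (u Fin.≟ v) then c else 0) (allFin m) ≡ c
∑-δ {suc m} zero    c = trans (∑-allFin-suc {m} (λ u → if does (u Fin.≟ zero) then c else 0)) (trans (cong (c +_) (∑-zero (allFin m))) (+-identityʳ c))
∑-δ {suc m} (suc v) c = trans (∑-allFin-suc {m} (λ u → if does (u Fin.≟ suc v) then c else 0)) (∑-δ v c)

∧-true : ∀ {a b} → a ∧ b ≡ true → a ≡ true × b ≡ true
∧-true {true} {true} _ = refl , refl

-- Small cuts and low degrees against a `(k + 1)`-edge-connected subgraph.

module _ {G : Graph} {k : ℕ} (H : Subgraph G) (conn : EdgeConnected (k + 1) H) where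

  -- Otherwise `S` splits `H` into two nonempty sides joined by at least `k + 1` edges, while `f`
  -- gives each such edge weight at least 1 and has total at most `k`. Leaving `f` free lets the
  -- edges be counted through labels later on.
  few-crossing⇒one-side : (S : Fin (n G) → Bool) (f : Fin (n G) → Fin (n G) → ℕ) →
    (∀ u v → inV H u ≡ true → inV H v ≡ true → S u ≡ true → S v ≡ false → adj G u v ≡ true → 1 ≤ f u v) →
    ∑ (λ u → ∑ (f u) (allFin (n G))) (allFin (n G)) ≤ k →
    ∃[ s ] (∀ u → inV H u ≡ true → S u ≡ s)
  few-crossing⇒one-side S f f-crossing f≤k
    with Fin.any? (λ u → (inV H u ∧ S u) Bool.≟ true)
       | Fin.any? (λ v → (inV H v ∧ not (S v)) Bool.≟ true)
  ... | no ∄u | _ = false , λ u u∈H → Bool.¬-not (λ Su → ∄u (u , cong₂ _∧_ u∈H Su))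
  ... | yes _ | no ∄v = true , λ v v∈H → Bool.¬-not (λ Sv → ∄v (v , cong₂ _∧_ v∈H (cong not Sv)))
  ... | yes (u , u∈) | yes (v , v∈) =
    contradiction (≤-trans (proj₂ conn A (λ _ → proj₁ ∘ ∧-true) (u , u∈) (v , v∈H , Av)) (≤-trans crossing≤ f≤k)) k+1≰k
    where
    A : Fin (n G) → Bool
    -- Edge-connectivity speaks only of subsets of the vertex set of `H`, hence the intersection.
    A w = inV H w ∧ S w
    k+1≰k : ¬ (k + 1 ≤ k)
    k+1≰k p = 1+n≰n (subst (_≤ k) (+-comm k 1) p)
    v∈H : inV H v ≡ true
    v∈H = proj₁ (∧-true v∈)
    Sv : S v ≡ false
    Sv = Bool.not-injective (proj₂ (∧-true {inV H v} v∈))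
    Av : A v ≡ false
    Av = trans (cong (inV H v ∧_) Sv) (Bool.∧-zeroʳ _)
    edge≤ : ∀ x y → ⟦ A x ∧ inV H x ∧ not (A y) ∧ inV H y ∧ inE H x y ⟧ ≤ f x y
    edge≤ x y with inV H x in x∈ | S x in Sx | inV H y in y∈ | S y in Sy | inE H x y in e
    ... | true | true | true | false | true = f-crossing x y x∈ y∈ Sx Sy (inE-adj H x y e)
    ... | true | true | true | false | false = z≤n
    ... | true | true | true | true | _ = z≤n
    ... | true | true | false | _ | _ = z≤n
    ... | true | false | _ | _ | _ = z≤n
    ... | false | _ | _ | _ | _ = z≤n
    crossing≤ : crossing H A ≤ ∑ (λ x → ∑ (f x) (allFin (n G))) (allFin (n G))
    crossing≤ = ∑-mono (λ x → ∑-mono (edge≤ x) (allFin (n G))) (allFin (n G))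

  -- This is the cut around the single vertex `v`: `H` contains `v`, and it has a second vertex, so
  -- it lies on neither side.
  many-neighbours : ∀ v → inV H v ≡ true → (f : Fin (n G) → ℕ) →
    (∀ w → inV H w ≡ true → adj G v w ≡ true → 1 ≤ f w) → ¬ (∑ f (allFin (n G)) ≤ k)
  many-neighbours v v∈H f f-nbr f≤k
    -- The weight lives in row `v` only, so the double sum collapses to `∑ f`.
    with few-crossing⇒one-side (λ u → does (u Fin.≟ v)) (λ u w → if does (u Fin.≟ v) then f w else 0) g-crossing g≤k
    where
    g-crossing : ∀ u w → inV H u ≡ true → inV H w ≡ true → does (u Fin.≟ v) ≡ true → does (w Fin.≟ v) ≡ false →
      adj G u w ≡ true → 1 ≤ (if does (u Fin.≟ v) then f w else 0)
    g-crossing u w u∈ w∈ _ _ e with u Fin.≟ v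
    ... | yes refl = f-nbr w w∈ e
    pull : ∀ b → ∑ (λ w → if b then f w else 0) (allFin (n G)) ≡ (if b then ∑ f (allFin (n G)) else 0)
    pull true  = refl
    pull false = ∑-zero (allFin (n G))
    g≤k : ∑ (λ u → ∑ (λ w → if does (u Fin.≟ v) then f w else 0) (allFin (n G))) (allFin (n G)) ≤ k
    g≤k = subst (_≤ k) (sym (trans (∑-cong (λ u → pull (does (u Fin.≟ v))) (allFin (n G))) (∑-δ v _))) f≤k
  ... | false , all-false = contradiction (trans (sym (dec-true (v Fin.≟ v) refl)) (all-false v v∈H)) λ ()
  ... | true , all-true = x≢y (trans (is-v x x∈H) (sym (is-v y y∈H)))
    where
    x = proj₁ (proj₁ conn)
    y = proj₁ (proj₂ (proj₁ conn))
    x≢y = proj₁ (proj₂ (proj₂ (proj₁ conn)))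
    x∈H = proj₁ (proj₂ (proj₂ (proj₂ (proj₁ conn))))
    y∈H = proj₂ (proj₂ (proj₂ (proj₂ (proj₁ conn))))
    is-v : ∀ u → inV H u ≡ true → u ≡ v
    is-v u u∈ with u Fin.≟ v | all-true u u∈
    ... | yes eq | _ = eq

-- The tree graph.

-- Vertices up to multiplicity: enum below lists t copies of each B x and a copies of each
-- A x, which are therefore pairwise non-adjacent twins.  D x descends into half x.
data V : ℕ → Set where
  B : Bool → V 0
  F : Bool → ℕ → V 0
  A : ∀ {j} → Bool → V (suc j)
  D : ∀ {j} → Bool → V j → V (suc j)

-- All B's (if β holds), together with m vertices of a single leaf: no hub needs to
-- have its neighbours spread evenly over the leaves.
mark : ∀ {j} → Bool → ℕ → V j → Bool
mark β m (B x)       = β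
mark β m (F false i) = i <ᵇ m
mark β m (F true i)  = false
mark β m (A x)       = false
mark β m (D false v) = mark β m v
mark β m (D true v)  = mark β 0 v

module Tree (k t a : ℕ) where

  -- The number of B's below a node at height j.
  #B : ℕ → ℕ
  #B j = 2 ^ j * (t + t)

  #B-suc : ∀ j → #B (suc j) ≡ #B j + #B j
  #B-suc j = lemma (2 ^ j) t
    where
    lemma : ∀ p t → 2 * p * (t + t) ≡ p * (t + t) + p * (t + t)
    lemma = solve-∀

  #B-mono : ∀ j → #B j ≤ #B (suc j)
  #B-mono j = subst (#B j ≤_) (sym (#B-suc j)) (m≤m+n (#B j) (#B j))

  enum : ∀ j → List (V j)
  enum zero    = (replicate t (B false) ++ map (F false) (upTo k)) ++ (replicate t (B true) ++ map (F true) (upTo k))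
  enum (suc j) = (replicate a (A false) ++ map (D false) (enum j)) ++ (replicate a (A true) ++ map (D true) (enum j))

  ∑-enum-zero : ∀ f → ∑ f (enum 0) ≡
    (t * f (B false) + ∑ (f ∘ F false) (upTo k)) + (t * f (B true) + ∑ (f ∘ F true) (upTo k))
  ∑-enum-zero f = trans (∑-++ f (replicate t (B false) ++ _) _) (cong₂ _+_ (half false) (half true))
    where
    half : ∀ x → ∑ f (replicate t (B x) ++ map (F x) (upTo k)) ≡ t * f (B x) + ∑ (f ∘ F x) (upTo k)
    half x = trans (∑-++ f (replicate t (B x)) _) (cong₂ _+_ (∑-replicate f t (B x)) (∑-map f (F x) (upTo k)))

  ∑-enum-suc : ∀ {j} f → ∑ f (enum (suc j)) ≡
    (a * f (A false) + ∑ (f ∘ D false) (enum j)) + (a * f (A true) + ∑ (f ∘ D true) (enum j))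
  ∑-enum-suc {j} f = trans (∑-++ f (replicate a (A false) ++ _) _) (cong₂ _+_ (half false) (half true))
    where
    half : ∀ x → ∑ f (replicate a (A x) ++ map (D x) (enum j)) ≡ a * f (A x) + ∑ (f ∘ D x) (enum j)
    half x = trans (∑-++ f (replicate a (A x)) _) (cong₂ _+_ (∑-replicate f a (A x)) (∑-map f (D x) (enum j)))

  -- Only the `false` child inherits `m`, so the F's are counted in one leaf, which has room for
  -- them because `m ≤ k`.
  ∑-mark : ∀ j β {m} → m ≤ k → ∑ (λ v → ⟦ mark β m v ⟧) (enum j) ≡ ⟦ β ⟧ * #B j + m
  ∑-mark zero β {m} m≤k = begin
    ∑ (λ v → ⟦ mark β m v ⟧) (enum 0)
      ≡⟨ ∑-enum-zero _ ⟩
    (t * ⟦ β ⟧ + ∑ (λ i → ⟦ i <ᵇ m ⟧) (upTo k)) + (t * ⟦ β ⟧ + ∑ (const 0) (upTo k))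
      ≡⟨ cong₂ (λ p q → (t * ⟦ β ⟧ + p) + (t * ⟦ β ⟧ + q)) (∑-<ᵇ m≤k) (∑-zero (upTo k)) ⟩
    (t * ⟦ β ⟧ + m) + (t * ⟦ β ⟧ + 0)
      ≡⟨ lemma t ⟦ β ⟧ m ⟩
    ⟦ β ⟧ * #B 0 + m ∎
    where
    open ≡-Reasoning
    lemma : ∀ t b m → (t * b + m) + (t * b + 0) ≡ b * (1 * (t + t)) + m
    lemma = solve-∀
  ∑-mark (suc j) β {m} m≤k = begin
    ∑ (λ v → ⟦ mark β m v ⟧) (enum (suc j))
      ≡⟨ ∑-enum-suc {j} _ ⟩
    (a * 0 + ∑ (λ v → ⟦ mark β m v ⟧) (enum j)) + (a * 0 + ∑ (λ v → ⟦ mark β 0 v ⟧) (enum j))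
      ≡⟨ cong₂ (λ p q → (a * 0 + p) + (a * 0 + q)) (∑-mark j β m≤k) (∑-mark j β z≤n) ⟩
    (a * 0 + (⟦ β ⟧ * #B j + m)) + (a * 0 + (⟦ β ⟧ * #B j + 0))
      ≡⟨ lemma a ⟦ β ⟧ (#B j) m ⟩
    ⟦ β ⟧ * (#B j + #B j) + m
      ≡⟨ cong (λ p → ⟦ β ⟧ * p + m) (#B-suc j) ⟨
    ⟦ β ⟧ * #B (suc j) + m ∎
    where
    open ≡-Reasoning
    lemma : ∀ a b p m → (a * 0 + (b * p + m)) + (a * 0 + (b * p + 0)) ≡ b * (p + p) + m
    lemma = solve-∀

  -- Neighbours of a hub in its own half (false) and in the opposite half (true).
  link : ∀ {j} → Bool → V j → Bool
  link {j} false = mark true (k ∸ #B j)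
  link     true  = mark false t

  infix 4 _~_
  -- A leaf is the complete bipartite graph between two classes of `k` F's, with `t` B's joined to
  -- all of each class. Higher up, an edge between the two halves of a node always has one of that
  -- node's hubs as exactly one of its ends.
  _~_ : ∀ {j} → V j → V j → Bool
  B x   ~ B y   = false
  B x   ~ F y _ = not (x xor y)
  F x _ ~ B y   = not (x xor y)
  F x _ ~ F y _ = x xor y
  A x   ~ A y   = false
  A x   ~ D y v = link (x xor y) v
  D x u ~ A y   = link (x xor y) u
  D x u ~ D y v = not (x xor y) ∧ (u ~ v)

  ~-sym : ∀ {j} (u v : V j) → (u ~ v) ≡ (v ~ u)
  ~-sym (B x)   (B y)   = refl
  ~-sym (B x)   (F y _) = cong not (Bool.xor-comm x y)
  ~-sym (F x _) (B y)   = cong not (Bool.xor-comm x y)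
  ~-sym (F x _) (F y _) = Bool.xor-comm x y
  ~-sym (A x)   (A y)   = refl
  ~-sym (A x)   (D y v) = cong (λ b → link b v) (Bool.xor-comm x y)
  ~-sym (D x u) (A y)   = cong (λ b → link b u) (Bool.xor-comm x y)
  ~-sym (D x u) (D y v) = cong₂ (λ b c → not b ∧ c) (Bool.xor-comm x y) (~-sym u v)

  ~-irr : ∀ {j} (v : V j) → (v ~ v) ≡ false
  ~-irr (B x)   = refl
  ~-irr (F x _) = Bool.xor-same x
  ~-irr (A x)   = refl
  ~-irr (D x v) = trans (cong (not (x xor x) ∧_) (~-irr v)) (Bool.∧-zeroʳ _)

  graph : ℕ → Graph
  graph j = record
    { n       = length (enum j)
    ; adj     = λ u v → lookup (enum j) u ~ lookup (enum j) v
    ; adj-sym = λ u v → ~-sym (lookup (enum j) u) (lookup (enum j) v)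
    ; adj-irr = λ v → ~-irr (lookup (enum j) v)
    }

  -- Degrees in the tree graph.

  module _ (t≤k : t ≤ k) where

    ∑-link-true : ∀ j → ∑ (λ v → ⟦ link true v ⟧) (enum j) ≡ t
    ∑-link-true j = ∑-mark j false t≤k

    -- The hypothesis keeps the truncated subtraction in `link` exact: the F's fill up what the B's
    -- leave of `k`.
    ∑-link-false : ∀ j → #B j ≤ k → ∑ (λ v → ⟦ link false v ⟧) (enum j) ≡ k
    ∑-link-false j #B≤k = trans (∑-mark j true (m∸n≤m k (#B j)))
      (trans (cong (_+ (k ∸ #B j)) (*-identityˡ (#B j))) (m+[n∸m]≡n #B≤k))


    degᵥ : ∀ {j} → V j → ℕ
    degᵥ {j} u = ∑ (λ v → ⟦ u ~ v ⟧) (enum j)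

    degᵥ-B : ∀ x → degᵥ (B x) ≡ k
    degᵥ-B false = trans (∑-enum-zero _) (trans
      (cong₂ (λ p q → (t * 0 + p) + (t * 0 + q)) (∑-one k) (∑-zero (upTo k))) (lemma t k))
      where
      lemma : ∀ t k → (t * 0 + k) + (t * 0 + 0) ≡ k
      lemma = solve-∀
    degᵥ-B true = trans (∑-enum-zero _) (trans
      (cong₂ (λ p q → (t * 0 + p) + (t * 0 + q)) (∑-zero (upTo k)) (∑-one k)) (lemma t k))
      where
      lemma : ∀ t k → (t * 0 + 0) + (t * 0 + k) ≡ k
      lemma = solve-∀

    degᵥ-F : ∀ x i → degᵥ (F x i) ≡ k + t
    degᵥ-F false i = trans (∑-enum-zero _) (trans
      (cong₂ (λ p q → (t * 1 + p) + (t * 0 + q)) (∑-zero (upTo k)) (∑-one k)) (lemma t k))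
      where
      lemma : ∀ t k → (t * 1 + 0) + (t * 0 + k) ≡ k + t
      lemma = solve-∀
    degᵥ-F true i = trans (∑-enum-zero _) (trans
      (cong₂ (λ p q → (t * 0 + p) + (t * 1 + q)) (∑-one k) (∑-zero (upTo k))) (lemma t k))
      where
      lemma : ∀ t k → (t * 0 + k) + (t * 1 + 0) ≡ k + t
      lemma = solve-∀

    degᵥ-A : ∀ j x → #B j ≤ k → degᵥ (A {j} x) ≡ k + t
    degᵥ-A j false #B≤k = trans (∑-enum-suc {j} _) (trans
      (cong₂ (λ p q → (a * 0 + p) + (a * 0 + q)) (∑-link-false j #B≤k) (∑-link-true j)) (lemma a k t))
      where
      lemma : ∀ a k t → (a * 0 + k) + (a * 0 + t) ≡ k + t
      lemma = solve-∀
    degᵥ-A j true #B≤k = trans (∑-enum-suc {j} _) (trans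
      (cong₂ (λ p q → (a * 0 + p) + (a * 0 + q)) (∑-link-true j) (∑-link-false j #B≤k)) (lemma a k t))
      where
      lemma : ∀ a k t → (a * 0 + t) + (a * 0 + k) ≡ k + t
      lemma = solve-∀

    -- The hubs of the opposite half are dropped, as only a lower bound is wanted.
    degᵥ-D : ∀ {j} x (u : V j) → a * ⟦ link false u ⟧ + degᵥ u ≤ degᵥ (D x u)
    degᵥ-D {j} false u = subst (a * ⟦ link false u ⟧ + degᵥ u ≤_) (sym (∑-enum-suc {j} _)) (m≤m+n _ _)
    degᵥ-D {j} true  u = subst (a * ⟦ link false u ⟧ + degᵥ u ≤_) (sym (∑-enum-suc {j} _))
      (m≤n+m _ (a * ⟦ link true u ⟧ + ∑ (const 0) (enum j)))

    mark-B : ∀ {j} m (u : V j) → mark true 0 u ≡ true → mark true m u ≡ true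
    mark-B m (B x)       p = refl
    mark-B m (F false _) ()
    mark-B m (F true _)  ()
    mark-B m (D false u) p = mark-B m u p
    mark-B m (D true u)  p = p

    mark-D : ∀ {j} x (u : V j) → mark true 0 (D x u) ≡ mark true 0 u
    mark-D false u = refl
    mark-D true  u = refl

    -- `mark true 0` singles out the B's. They start with degree `k` in their leaf and gain `a` hubs
    -- per level; every F or A has degree `k + t` already at the level where it appears, and going
    -- up never lowers a degree.
    degᵥ-lower : ∀ {j} (u : V j) → #B j ≤ k → k + (if mark true 0 u then j * a else t) ≤ degᵥ u
    degᵥ-lower (B x)       #B≤k = ≤-reflexive (trans (+-identityʳ k) (sym (degᵥ-B x)))
    degᵥ-lower (F false i) #B≤k = ≤-reflexive (sym (degᵥ-F false i))
    degᵥ-lower (F true i)  #B≤k = ≤-reflexive (sym (degᵥ-F true i))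
    degᵥ-lower (A {j} x)   #B≤k = ≤-reflexive (sym (degᵥ-A j x (≤-trans (#B-mono j) #B≤k)))
    degᵥ-lower {suc j} (D x u) #B≤k rewrite mark-D x u =
      ≤-trans (step (mark true 0 u) refl (degᵥ-lower u (≤-trans (#B-mono j) #B≤k))) (degᵥ-D x u)
      where
      step : ∀ b → mark true 0 u ≡ b → k + (if b then j * a else t) ≤ degᵥ u →
        k + (if b then suc j * a else t) ≤ a * ⟦ link false u ⟧ + degᵥ u
      -- A hub is joined to every B of its own half, however many F's it takes besides.
      step true isB ih rewrite mark-B (k ∸ #B j) u isB = ≤-trans (≤-reflexive (lemma k a (j * a))) (+-monoʳ-≤ (a * 1) ih)
        where
        lemma : ∀ k a p → k + (a + p) ≡ a * 1 + (k + p)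
        lemma = solve-∀
      step false _ ih = ≤-trans ih (m≤n+m _ _)

    -- The cut between the two halves of a node.

    side : ∀ {j} → V (suc j) → Bool
    side (A x)   = x
    side (D x _) = x

    crossᵥ : ∀ {j} → V (suc j) → V (suc j) → ℕ
    crossᵥ u v = ⟦ side u ∧ not (side v) ∧ (u ~ v) ⟧

    -- Each edge is counted once, from its `true` end. The `a` hubs there send `t` edges each, and
    -- the other `a * t` edges arrive from the hubs of the `false` half; two D's in different halves
    -- are never adjacent.
    ∑-crossᵥ : ∀ j → ∑ (λ u → ∑ (crossᵥ u) (enum (suc j))) (enum (suc j)) ≡ a * (t + t)
    ∑-crossᵥ j = begin
      ∑ (λ u → ∑ (crossᵥ u) (enum (suc j))) (enum (suc j))
        ≡⟨ ∑-enum-suc {j} _ ⟩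
      (a * ∑ (const 0) (enum (suc j)) + ∑ (const (∑ (const 0) (enum (suc j)))) (enum j)) +
      (a * ∑ (crossᵥ (A true)) (enum (suc j)) + ∑ (λ u → ∑ (crossᵥ (D true u)) (enum (suc j))) (enum j))
        ≡⟨ cong₂ _+_
             (cong₂ _+_ (cong (a *_) (∑-zero (enum (suc j))))
               (trans (∑-cong (λ _ → ∑-zero (enum (suc j))) (enum j)) (∑-zero (enum j))))
             (cong₂ _+_ (cong (a *_) from-A) (trans (∑-cong from-D (enum j))
               (trans (∑-* a _ (enum j)) (cong (a *_) (∑-link-true j))))) ⟩
      (a * 0 + 0) + (a * t + a * t)
        ≡⟨ lemma a t ⟩
      a * (t + t) ∎
      where
      open ≡-Reasoning
      lemma : ∀ a t → (a * 0 + 0) + (a * t + a * t) ≡ a * (t + t)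
      lemma = solve-∀
      from-A : ∑ (crossᵥ (A {j} true)) (enum (suc j)) ≡ t
      from-A = trans (∑-enum-suc {j} _) (trans
        (cong₂ (λ p q → (a * 0 + p) + (a * 0 + q)) (∑-link-true j) (∑-zero (enum j))) (lemma′ a t))
        where
        lemma′ : ∀ a t → (a * 0 + t) + (a * 0 + 0) ≡ t
        lemma′ = solve-∀
      from-D : ∀ u → ∑ (crossᵥ (D {j} true u)) (enum (suc j)) ≡ a * ⟦ link true u ⟧
      from-D u = trans (∑-enum-suc {j} _) (trans
        (cong₂ (λ p q → (a * ⟦ link true u ⟧ + p) + (a * 0 + q)) (∑-zero (enum j)) (∑-zero (enum j)))
        (lemma′ a (a * ⟦ link true u ⟧)))
        where
        lemma′ : ∀ a p → (p + 0) + (a * 0 + 0) ≡ p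
        lemma′ = solve-∀

    strip : ∀ {j} → Bool → V (suc j) → Maybe (V j)
    strip s     (A x)       = nothing
    strip false (D false v) = just v
    strip true  (D true v)  = just v
    strip _     (D _ v)     = nothing

    strip-just : ∀ {j} s (u : V (suc j)) {v} → strip s u ≡ just v → u ≡ D s v
    strip-just false (D false v) refl = refl
    strip-just true  (D true v)  refl = refl

    ∑-strip : ∀ {j} s (f : V j → ℕ) → ∑ (maybe′ f 0 ∘ strip s) (enum (suc j)) ≡ ∑ f (enum j)
    ∑-strip {j} false f = trans (∑-enum-suc {j} _) (trans
      (cong (λ q → (a * 0 + ∑ f (enum j)) + (a * 0 + q)) (∑-zero (enum j))) (lemma a _))
      where
      lemma : ∀ a p → (a * 0 + p) + (a * 0 + 0) ≡ p
      lemma = solve-∀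
    ∑-strip {j} true f = trans (∑-enum-suc {j} _) (trans
      (cong (λ q → (a * 0 + q) + (a * 0 + ∑ f (enum j))) (∑-zero (enum j))) (lemma a _))
      where
      lemma : ∀ a p → (a * 0 + 0) + (a * 0 + p) ≡ p
      lemma = solve-∀

    -- Chasing the subgraph down the tree.

    module _ {G : Graph} (H : Subgraph G) (conn : EdgeConnected (k + 1) H) where

      -- H lies in the copy of V j below some node of the tree; label is undefined on
      -- the vertices of G outside that copy.
      record Located (j : ℕ) : Set where
        field
          label    : Fin (n G) → Maybe (V j)
          covers   : ∀ {u} → inV H u ≡ true → ∃[ x ] label u ≡ just x
          respects : ∀ {u v x y} → label u ≡ just x → label v ≡ just y → adj G u v ≡ true → (x ~ y) ≡ true
          sums     : ∀ f → ∑ (maybe′ f 0 ∘ label) (allFin (n G)) ≤ ∑ f (enum j)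

      -- Twins share a label, so labels are not injective; `sums` takes the place of injectivity and
      -- bounds the edges of `G` across the cut by the count over `enum`.
      located-one-side : ∀ {j} (L : Located (suc j)) → a * (t + t) ≤ k →
        ∃[ s ] (∀ u {x} → inV H u ≡ true → Located.label L u ≡ just x → side x ≡ s)
      located-one-side {j} L cut≤k
        with few-crossing⇒one-side H conn (maybe′ side false ∘ label) f f-crossing f≤k
        where
        open Located L
        f : Fin (n G) → Fin (n G) → ℕ
        f u v = maybe′ (λ x → maybe′ (crossᵥ x) 0 (label v)) 0 (label u)
        f-crossing : ∀ u v → inV H u ≡ true → inV H v ≡ true → maybe′ side false (label u) ≡ true →
          maybe′ side false (label v) ≡ false → adj G u v ≡ true → 1 ≤ f u v
        f-crossing u v u∈ v∈ Su Sv e with covers u∈ | covers v∈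
        ... | x , px | y , py with respects px py e
        ... | x~y rewrite px | py | Su | Sv | x~y = s≤s z≤n
        inner : ∀ u → ∑ (f u) (allFin (n G)) ≤ maybe′ (λ x → ∑ (crossᵥ x) (enum (suc j))) 0 (label u)
        inner u with label u
        ... | just x  = sums (crossᵥ x)
        ... | nothing = ≤-reflexive (∑-zero (allFin (n G)))
        f≤k : ∑ (λ u → ∑ (f u) (allFin (n G))) (allFin (n G)) ≤ k
        f≤k = ≤-trans (∑-mono inner (allFin (n G))) (≤-trans (sums _) (≤-trans (≤-reflexive (∑-crossᵥ j)) cut≤k))
      ... | s , on-side = s , λ u u∈ px → trans (cong (maybe′ side false) (sym px)) (on-side u u∈)

      -- `P` records what is already known of the labels in `H`, so that vertices excluded earlier
      -- no longer count as neighbours.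
      located-many-neighbours : ∀ {j} (L : Located j) (P : V j → Bool) →
        (∀ u {x} → inV H u ≡ true → Located.label L u ≡ just x → P x ≡ true) →
        ∀ u {x} → inV H u ≡ true → Located.label L u ≡ just x →
        ¬ (∑ (λ y → ⟦ P y ∧ (x ~ y) ⟧) (enum j) ≤ k)
      located-many-neighbours {j} L P inP u {x} u∈ px le =
        many-neighbours H conn u u∈ (maybe′ f 0 ∘ label) f-nbr (≤-trans (sums f) le)
        where
        open Located L
        f : V j → ℕ
        f y = ⟦ P y ∧ (x ~ y) ⟧
        f-nbr : ∀ w → inV H w ≡ true → adj G u w ≡ true → 1 ≤ maybe′ f 0 (label w)
        f-nbr w w∈ e with covers w∈
        ... | y , py with inP w w∈ py | respects px py e
        ... | Py | x~y rewrite py | Py | x~y = s≤s z≤n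

      not-located-zero : ¬ Located 0
      not-located-zero L = no-F (proj₁ (proj₁ conn)) (proj₁ (proj₂ (proj₂ (proj₂ (proj₁ conn)))))
        where
        open Located L
        isF : V 0 → Bool
        isF (B _)   = false
        isF (F _ _) = true
        all-F : ∀ u {x} → inV H u ≡ true → label u ≡ just x → isF x ≡ true
        all-F u {B x}   u∈ px =
          -- The B's go first, with no restriction on labels: their degree inside the leaf is
          -- already `k`.
          contradiction (≤-reflexive (degᵥ-B x)) (located-many-neighbours L (const true) (λ _ _ _ → refl) u u∈ px)
        all-F u {F x i} u∈ px = refl
        F-degree : ∀ x i → ∑ (λ y → ⟦ isF y ∧ (F x i ~ y) ⟧) (enum 0) ≡ k
        F-degree false i = trans (∑-enum-zero _) (trans
          (cong₂ (λ p q → (t * 0 + p) + (t * 0 + q)) (∑-zero (upTo k)) (∑-one k)) (lemma t k))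
          where
          lemma : ∀ t k → (t * 0 + 0) + (t * 0 + k) ≡ k
          lemma = solve-∀
        F-degree true i = trans (∑-enum-zero _) (trans
          (cong₂ (λ p q → (t * 0 + p) + (t * 0 + q)) (∑-one k) (∑-zero (upTo k))) (lemma t k))
          where
          lemma : ∀ t k → (t * 0 + k) + (t * 0 + 0) ≡ k
          lemma = solve-∀
        no-F : ∀ u → inV H u ≡ true → ⊥
        no-F u u∈ with covers u∈
        ... | F x i , px = located-many-neighbours L isF all-F u u∈ px (≤-reflexive (F-degree x i))
        ... | B x , px = contradiction (all-F u u∈ px) λ ()

      descend : ∀ {j} → a * (t + t) ≤ k → #B j ≤ k → Located (suc j) → Located j
      descend {j} cut≤k #B≤k L with located-one-side L cut≤k
      ... | s , on-side = record
        -- Hubs and the other half lose their label; `covers` survives because none of them is in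
        -- `H`.
        { label    = λ u → label u >>= strip s
        ; covers   = covers′
        ; respects = respects′
        ; sums     = λ f → ≤-trans (≤-reflexive (∑-cong (λ u → maybe-strip f (label u)) (allFin (n G))))
                             (≤-trans (sums (maybe′ f 0 ∘ strip s)) (≤-reflexive (∑-strip s f)))
        }
        where
        open Located L
        P : V (suc j) → Bool
        P x = not (side x xor s)
        inP : ∀ u {x} → inV H u ≡ true → label u ≡ just x → P x ≡ true
        inP u u∈ px = cong not (trans (cong (_xor s) (on-side u u∈ px)) (Bool.xor-same s))
        -- Restricting to half `s` removes the `t` cross neighbours of the hub and leaves `k`.
        A-degree : ∀ s → ∑ (λ y → ⟦ not (side y xor s) ∧ (A s ~ y) ⟧) (enum (suc j)) ≡ k
        A-degree false = trans (∑-enum-suc {j} _) (trans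
          (cong₂ (λ p q → (a * 0 + p) + (a * 0 + q)) (∑-link-false j #B≤k) (∑-zero (enum j))) (lemma a k))
          where
          lemma : ∀ a k → (a * 0 + k) + (a * 0 + 0) ≡ k
          lemma = solve-∀
        A-degree true = trans (∑-enum-suc {j} _) (trans
          (cong₂ (λ p q → (a * 0 + p) + (a * 0 + q)) (∑-zero (enum j)) (∑-link-false j #B≤k)) (lemma a k))
          where
          lemma : ∀ a k → (a * 0 + 0) + (a * 0 + k) ≡ k
          lemma = solve-∀
        strip-D : ∀ s (v : V j) → strip s (D s v) ≡ just v
        strip-D false v = refl
        strip-D true  v = refl
        covers′ : ∀ {u} → inV H u ≡ true → ∃[ x ] (label u >>= strip s) ≡ just x
        covers′ {u} u∈ with covers u∈
        ... | A x , px with on-side u u∈ px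
        ... | refl = contradiction (≤-reflexive (A-degree s)) (located-many-neighbours L P inP u u∈ px)
        covers′ {u} u∈ | D x v , px with on-side u u∈ px
        ... | refl = v , trans (cong (_>>= strip s) px) (strip-D s v)
        unstrip : ∀ m {v} → (m >>= strip s) ≡ just v → m ≡ just (D s v)
        unstrip (just u) p = cong just (strip-just s u p)
        respects′ : ∀ {u v x y} → (label u >>= strip s) ≡ just x → (label v >>= strip s) ≡ just y →
          adj G u v ≡ true → (x ~ y) ≡ true
        respects′ {u} {v} px py e =
          -- Both labels lie under the same `D s`, where adjacency is a conjunction ending in
          -- `x ~ y`.
          proj₂ (∧-true {not (s xor s)} (respects (unstrip (label u) px) (unstrip (label v) py) e))
        maybe-strip : ∀ f m → maybe′ f 0 (m >>= strip s) ≡ maybe′ (maybe′ f 0 ∘ strip s) 0 m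
        maybe-strip f (just x) = refl
        maybe-strip f nothing  = refl

      not-located : ∀ j → a * (t + t) ≤ k → #B j ≤ k → ¬ Located j
      not-located zero    cut≤k #B≤k L = not-located-zero L
      not-located (suc j) cut≤k #B≤k L = not-located j cut≤k #B≤k′ (descend cut≤k #B≤k′ L)
        where
        #B≤k′ : #B j ≤ k
        #B≤k′ = ≤-trans (#B-mono j) #B≤k

    no-edge-connected : ∀ j → a * (t + t) ≤ k → #B j ≤ k → ¬ (∃[ H ] EdgeConnected {graph j} (k + 1) H)
    no-edge-connected j cut≤k #B≤k (H , conn) = not-located H conn j cut≤k #B≤k (record
      -- At the root every vertex is labelled by its own entry of `enum j`.
      { label    = just ∘ lookup (enum j)
      ; covers   = λ _ → _ , refl
      ; respects = λ { refl refl e → e }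
      ; sums     = λ f → ≤-reflexive (∑-lookup f (enum j))
      })

    -- After `j` levels the B's exceed `k` by `j * a`, which `t ≤ j * a` brings level with the
    -- excess `t` of the others.
    degree-lower : ∀ j → t ≤ j * a → #B j ≤ k → ∀ v → k + t ≤ degree (graph j) v
    degree-lower j t≤ja #B≤k v = ≤-trans (+-monoʳ-≤ k (t≤if (mark true 0 u)))
      (≤-trans (degᵥ-lower u #B≤k) (≤-reflexive (sym (∑-lookup (λ w → ⟦ u ~ w ⟧) (enum j)))))
      where
      u = lookup (enum j) v
      t≤if : ∀ b → t ≤ (if b then j * a else t)
      t≤if true  = t≤ja
      t≤if false = ≤-refl

  -- It makes the graph nonempty; on no vertices the degree condition would be vacuous.
  k≤order : ∀ j → k ≤ n (graph j)
  k≤order j = subst (k ≤_) (trans (∑-const 1 (enum j)) (*-identityʳ _)) (go j)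
    where
    go : ∀ j → k ≤ ∑ (const 1) (enum j)
    go zero = begin
      k                                      ≡⟨ ∑-one k ⟨
      ∑ (const 1) (upTo k)                   ≤⟨ m≤n+m _ _ ⟩
      t * 1 + ∑ (const 1) (upTo k)           ≤⟨ m≤m+n _ _ ⟩
      _                                      ≡⟨ ∑-enum-zero _ ⟨
      ∑ (const 1) (enum 0)                   ∎
      where open ≤-Reasoning
    go (suc j) = begin
      k                                      ≤⟨ go j ⟩
      ∑ (const 1) (enum j)                   ≤⟨ m≤n+m _ _ ⟩
      a * 1 + ∑ (const 1) (enum j)           ≤⟨ m≤m+n _ _ ⟩
      _                                      ≡⟨ ∑-enum-suc {j} _ ⟨
      ∑ (const 1) (enum (suc j))             ∎
      where open ≤-Reasoning

-- Choice of the parameters.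

theorem6 : (C : ℕ) →
    ∃[ k ] (1 ≤ k × ∃[ G ] (1 ≤ n G × MinDegreeAtLeast G k C ×
    ¬ (∃[ H ] EdgeConnected {G} (k + 1) H)))
theorem6 C = k , 1≤k , graph d , ≤-trans 1≤k (k≤order d) , min-degree , no-edge-connected t≤k d ≤-refl ≤-refl
  where
  d a t k : ℕ
  -- The successor keeps `d`, and with it `t` and `k`, positive when `C` is 0. With `a = 2 ^ d` both
  -- `#B d` and the cut size `a * (t + t)` are `k` itself, so the bounds on them hold by
  -- reflexivity.
  d = suc (2 * (C * C))
  a = 2 ^ d
  t = d * a
  k = a * (t + t)
  open Tree k t a
  1≤a : 1 ≤ a
  1≤a = m^n>0 2 d
  1≤t : 1 ≤ t
  1≤t = *-mono-≤ {1} {d} (s≤s z≤n) 1≤a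
  1≤k : 1 ≤ k
  1≤k = *-mono-≤ 1≤a (≤-trans 1≤t (m≤m+n t t))
  t≤k : t ≤ k
  t≤k = ≤-trans (m≤m+n t t) (subst (_≤ k) (*-identityˡ (t + t)) (*-monoˡ-≤ (t + t) 1≤a))
  CCk≤tt : C * C * k ≤ t ^ 2
  CCk≤tt = begin
    C * C * (a * (t + t))    ≡⟨ lemma₁ (C * C) a t ⟩
    2 * (C * C) * (a * t)    ≤⟨ *-monoˡ-≤ (a * t) (n≤1+n (2 * (C * C))) ⟩
    d * (a * t)              ≡⟨ lemma₂ d a ⟩
    t ^ 2                    ∎
    where
    open ≤-Reasoning
    lemma₁ : ∀ c a t → c * (a * (t + t)) ≡ 2 * c * (a * t)
    lemma₁ = solve-∀
    -- The factor 1 comes from unfolding `t ^ 2`.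
    lemma₂ : ∀ d a → d * (a * (d * a)) ≡ d * a * (d * a * 1)
    lemma₂ = solve-∀
  min-degree : MinDegreeAtLeast (graph d) k C
  min-degree v = ≤-trans (m≤m+n k t) k+t≤deg ,
    ≤-trans CCk≤tt (^-monoˡ-≤ 2 (subst (_≤ degree (graph d) v ∸ k) (m+n∸m≡n k t) (∸-monoˡ-≤ k k+t≤deg)))
    where
    k+t≤deg : k + t ≤ degree (graph d) v
    k+t≤deg = degree-lower t≤k d ≤-refl ≤-refl v
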